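{- Let $L$ and $L'$ be bounded distributive lattices, let $\phi:L\to L'$ be an injective map of lattices, and let $B$ be a finite discrete Boolean algebra. Let $\vdash$ and $\vdash'$ be the entailment relations of lattice maps $L\to B$ on $L\times B$ and of lattice maps $L'\to B$ on $L'\times B$, respectively (generated by the axioms listed in the context). Then the induced interpretation $$f_\phi:(L\times B,\vdash)\to(L'\times B,\vdash'),\qquad (x,a)\mapsto(\phi(x),a),$$ is conservative, i.e. for all finite subsets $X,Y$ of $L\times B$, $f_\phi(X)\vdash' f_\phi(Y)$ implies $X\vdash Y$.
   Context: Reasoning is constructive (formalizable in constructive Zermelo–Fraenkel set theory CZF). A set $S$ is finite if there are $n\in\mathbb N$ and a surjection $\{1,\dots,n\}\to S$; it is discrete if its equality is decidable. Lattices are distributive and bounded; maps of lattices preserve $\wedge,\vee,0,1$. An entailment relation on a set $S$ is a relation $\vdash$ between finite subsets of $S$ satisfying (R): $X\vdash Y$ whenever $X$ and $Y$ have a common element; (M): $X\vdash Y$ implies $X\cup X'\vdash Y\cup Y'$; (T): $X\vdash Y\cup\{x\}$ and $X\cup\{x\}\vdash Y$ imply $X\vdash Y$. Commas denote union, singleton braces are dropped, and an empty side is left blank. The entailment relation generated by a set of axioms (pairs of finite subsets) is the least one containing them. For a bounded distributive lattice $L$, the entailment relation of lattice maps $L\to B$ is the entailment relation on $L\times B$ generated by all instances of: (s) $(x,a),(x,b)\vdash$ for $a\neq b$; ($\wedge$) $(x,a),(y,b)\vdash(x\wedge y,a\wedge b)$; ($\vee$) $(x,a),(y,b)\vdash(x\vee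 y,a\vee b)$; (0) $\vdash(0_L,0_B)$; (1) $\vdash(1_L,1_B)$; (t) $\vdash\{(x,a):a\in B\}$. The one for $L'$ is defined in the same way with $L'$ in place of $L$. An interpretation of $(S,\vdash)$ in $(S',\vdash')$ is a function $f:S\to S'$ such that $X\vdash Y$ implies $f(X)\vdash' f(Y)$, where $f(X)$ denotes the image of $X$; the map $f_\phi$ is an interpretation. -}

module Defs where

open import Level using (Level; _⊔_; suc)
open import Algebra.Core using (Op₂)
open import Algebra.Definitions using (Identity)
open import Algebra.Lattice.Bundles using (DistributiveLattice; BooleanAlgebra)
open import Algebra.Lattice.Morphism.Structures using (IsLatticeHomomorphism)
open import Algebra.Lattice.Structures using (IsDistributiveLattice)
open import Data.Fin.Base using (Fin)
open import Data.List.Base using (List; []; _∷_; [_]; _++_; map; tabulate)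
open import Data.List.Properties using (map-++; map-tabulate)
import Data.List.Membership.Setoid as Membership
open import Data.List.Membership.Setoid.Properties using (∈-map⁺; ∈-map⁻; ∈-resp-≈)
import Data.List.Relation.Binary.Subset.Setoid as Subset
open import Data.List.Relation.Unary.Any using (here)
open import Data.Product.Base using (∃-syntax; _×_; _,_; proj₁; proj₂)
open import Data.Product.Relation.Binary.Pointwise.NonDependent using (×-setoid)
open import Function.Bundles using (Func; Surjection)
open import Relation.Binary.Bundles using (Setoid)
open import Relation.Binary.Core using (Rel; _⇒_)
open import Relation.Binary.Definitions using (Decidable)
open import Relation.Binary.PropositionalEquality as ≡ using ()

------------------------------------------------------------------------
-- Finite and discrete sets (a set is a setoid throughout)

Finite : ∀ {c ℓ : Level} → Setoid c ℓ → Set (c ⊔ ℓ)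
Finite S = ∃[ n ] Surjection (≡.setoid (Fin n)) S

Discrete : ∀ {c ℓ : Level} → Setoid c ℓ → Set (c ⊔ ℓ)
Discrete S = Decidable (Setoid._≈_ S)

------------------------------------------------------------------------
-- Bounded distributive lattices

record BoundedDistributiveLattice (c ℓ : Level) : Set (suc (c ⊔ ℓ)) where
  infixr 7 _∧_
  infixr 6 _∨_
  infix  4 _≈_
  field
    Carrier               : Set c
    _≈_                   : Rel Carrier ℓ
    _∨_                   : Op₂ Carrier
    _∧_                   : Op₂ Carrier
    ⊤                     : Carrier
    ⊥                     : Carrier
    isDistributiveLattice : IsDistributiveLattice _≈_ _∨_ _∧_
    ∧-identity            : Identity _≈_ ⊤ _∧_
    ∨-identity            : Identity _≈_ ⊥ _∨_

  open IsDistributiveLattice isDistributiveLattice public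

  distributiveLattice : DistributiveLattice c ℓ
  distributiveLattice = record
    { isDistributiveLattice = isDistributiveLattice }

  open DistributiveLattice distributiveLattice public
    using (setoid; rawLattice)

record LatticeMap {c ℓ c′ ℓ′ : Level}
                  (L  : BoundedDistributiveLattice c ℓ)
                  (L′ : BoundedDistributiveLattice c′ ℓ′)
                  : Set (c ⊔ ℓ ⊔ c′ ⊔ ℓ′) where
  private
    module L  = BoundedDistributiveLattice L
    module L′ = BoundedDistributiveLattice L′
  field
    to                    : L.Carrier → L′.Carrier
    isLatticeHomomorphism : IsLatticeHomomorphism L.rawLattice L′.rawLattice to
    ⊤-homo                : to L.⊤ L′.≈ L′.⊤
    ⊥-homo                : to L.⊥ L′.≈ L′.⊥

  open IsLatticeHomomorphism isLatticeHomomorphism public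

------------------------------------------------------------------------
-- Entailment relations

-- A finite subset is the image of some {1,…,n}, hence is given by a list
-- of its elements; two lists denote the same finite subset iff they are
-- related by _≋_.  Union is _++_, and X ∪ {x} is x ∷ X.

module FiniteSubsets {c ℓ : Level} (S : Setoid c ℓ) where
  open Membership S public using (_∈_)
  open Subset S public using (_⊆_)

  infix 4 _≋_
  _≋_ : Rel (List (Setoid.Carrier S)) (c ⊔ ℓ)
  X ≋ Y = X ⊆ Y × Y ⊆ X

-- The field resp says that _⊢_ is a relation between finite subsets, and
-- not merely between the lists that denote them.

record IsEntailmentRelation {c ℓ r : Level} (S : Setoid c ℓ)
                            (_⊢_ : Rel (List (Setoid.Carrier S)) r)
                            : Set (c ⊔ ℓ ⊔ r) where
  open FiniteSubsets S
  field
    resp : ∀ {X X′ Y Y′} → X ≋ X′ → Y ≋ Y′ → X ⊢ Y → X′ ⊢ Y′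
    R    : ∀ {X Y x} → x ∈ X → x ∈ Y → X ⊢ Y
    M    : ∀ {X Y} X′ Y′ → X ⊢ Y → (X ++ X′) ⊢ (Y ++ Y′)
    T    : ∀ {X Y} x → X ⊢ (x ∷ Y) → (x ∷ X) ⊢ Y → X ⊢ Y

record EntailmentRelation {c ℓ : Level} (S : Setoid c ℓ) (r : Level)
                          : Set (c ⊔ ℓ ⊔ suc r) where
  infix 4 _⊢_
  field
    _⊢_                  : Rel (List (Setoid.Carrier S)) r
    isEntailmentRelation : IsEntailmentRelation S _⊢_

  open IsEntailmentRelation isEntailmentRelation public

module _ {c ℓ a : Level} (S : Setoid c ℓ)
         (Ax : Rel (List (Setoid.Carrier S)) a) where
  open FiniteSubsets S

  data Generated : Rel (List (Setoid.Carrier S)) (c ⊔ ℓ ⊔ a) where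
    axiom : ∀ {X Y} → Ax X Y → Generated X Y
    resp  : ∀ {X X′ Y Y′} → X ≋ X′ → Y ≋ Y′ → Generated X Y → Generated X′ Y′
    R     : ∀ {X Y x} → x ∈ X → x ∈ Y → Generated X Y
    M     : ∀ {X Y} X′ Y′ → Generated X Y → Generated (X ++ X′) (Y ++ Y′)
    T     : ∀ {X Y} x → Generated X (x ∷ Y) → Generated (x ∷ X) Y → Generated X Y

  generated : EntailmentRelation S (c ⊔ ℓ ⊔ a)
  generated = record
    { _⊢_ = Generated
    ; isEntailmentRelation = record { resp = resp ; R = R ; M = M ; T = T }
    }

  generated-least : ∀ {r} {_⊢_ : Rel (List (Setoid.Carrier S)) r} →
                    IsEntailmentRelation S _⊢_ → Ax ⇒ _⊢_ → Generated ⇒ _⊢_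
  generated-least {_⊢_ = _⊢_} E ax = go
    where
    module E = IsEntailmentRelation E
    go : Generated ⇒ _⊢_
    go (axiom p)    = ax p
    go (resp p q d) = E.resp p q (go d)
    go (R p q)      = E.R p q
    go (M X′ Y′ d)  = E.M X′ Y′ (go d)
    go (T x d e)    = E.T x (go d) (go e)

------------------------------------------------------------------------
-- Interpretations

record Interpretation {c ℓ r c′ ℓ′ r′ : Level}
                      {S : Setoid c ℓ} {S′ : Setoid c′ ℓ′}
                      (E : EntailmentRelation S r)
                      (E′ : EntailmentRelation S′ r′)
                      : Set (c ⊔ ℓ ⊔ r ⊔ c′ ⊔ ℓ′ ⊔ r′) where
  private
    module E  = EntailmentRelation E
    module E′ = EntailmentRelation E′
  field
    func : Func S S′

  open Func func public using (to)

  field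
    preserves : ∀ {X Y} → X E.⊢ Y → map to X E′.⊢ map to Y

Conservative : ∀ {c ℓ r c′ ℓ′ r′ : Level}
               {S : Setoid c ℓ} {S′ : Setoid c′ ℓ′}
               {E : EntailmentRelation S r} {E′ : EntailmentRelation S′ r′} →
               Interpretation E E′ → Set (c ⊔ r ⊔ r′)
Conservative {E = E} {E′ = E′} i =
  ∀ X Y → map to X E′.⊢ map to Y → X E.⊢ Y
  where
  module E  = EntailmentRelation E
  module E′ = EntailmentRelation E′
  open Interpretation i using (to)

pullback : ∀ {c ℓ c′ ℓ′ r : Level} {S : Setoid c ℓ} {S′ : Setoid c′ ℓ′}
           (f : Func S S′) (E′ : EntailmentRelation S′ r) →
           IsEntailmentRelation S
             (λ X Y → EntailmentRelation._⊢_ E′ (map (Func.to f) X) (map (Func.to f) Y))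
pullback {S = S} {S′ = S′} f E′ = record
  { resp = λ (p , p⁻¹) (q , q⁻¹) →
      E′.resp (map-⊆ p , map-⊆ p⁻¹) (map-⊆ q , map-⊆ q⁻¹)
  ; R    = λ p q → E′.R (∈-map⁺ S S′ cong p) (∈-map⁺ S S′ cong q)
  ; M    = λ {X} {Y} X′ Y′ d →
      ≡.subst₂ E′._⊢_ (≡.sym (map-++ to X X′)) (≡.sym (map-++ to Y Y′))
        (E′.M (map to X′) (map to Y′) d)
  ; T    = λ x → E′.T (to x)
  }
  where
  module E′ = EntailmentRelation E′
  module F  = FiniteSubsets S
  module F′ = FiniteSubsets S′
  open Func f using (to; cong)
  map-⊆ : ∀ {X Y} → X F.⊆ Y → map to X F′.⊆ map to Y
  map-⊆ X⊆Y y∈fX with ∈-map⁻ S S′ y∈fX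
  ... | _ , x∈X , y≈fx =
    ∈-resp-≈ S′ (Setoid.sym S′ y≈fx) (∈-map⁺ S S′ cong (X⊆Y x∈X))

------------------------------------------------------------------------
-- The entailment relation of lattice maps L → B

module _ {c ℓ b β : Level} (L : BoundedDistributiveLattice c ℓ)
         (B : BooleanAlgebra b β) where
  private
    module L = BoundedDistributiveLattice L
    module B = BooleanAlgebra B

  graphSetoid : Setoid (c ⊔ b) (ℓ ⊔ β)
  graphSetoid = ×-setoid L.setoid B.setoid

  -- The enumeration of B serves only to list the finite subset
  -- {(x,a) : a ∈ B}, which up to _≋_ does not depend on it.

  data LatticeMapAxiom (fin : Finite B.setoid) :
         Rel (List (L.Carrier × B.Carrier)) (c ⊔ b ⊔ β) where
    ax-s : ∀ x {a a′} → a B.≉ a′ →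
           LatticeMapAxiom fin ((x , a) ∷ (x , a′) ∷ []) []
    ax-∧ : ∀ x y a a′ →
           LatticeMapAxiom fin ((x , a) ∷ (y , a′) ∷ []) [ (x L.∧ y , a B.∧ a′) ]
    ax-∨ : ∀ x y a a′ →
           LatticeMapAxiom fin ((x , a) ∷ (y , a′) ∷ []) [ (x L.∨ y , a B.∨ a′) ]
    ax-0 : LatticeMapAxiom fin [] [ (L.⊥ , B.⊥) ]
    ax-1 : LatticeMapAxiom fin [] [ (L.⊤ , B.⊤) ]
    ax-t : ∀ x →
           LatticeMapAxiom fin [] (tabulate (λ i → x , Surjection.to (proj₂ fin) i))

  latticeMaps : Finite B.setoid →
                EntailmentRelation graphSetoid (c ⊔ ℓ ⊔ b ⊔ β)
  latticeMaps fin = generated graphSetoid (LatticeMapAxiom fin)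

module _ {c ℓ c′ ℓ′ b β : Level}
         {L : BoundedDistributiveLattice c ℓ}
         {L′ : BoundedDistributiveLattice c′ ℓ′}
         (B : BooleanAlgebra b β) (fin : Finite (BooleanAlgebra.setoid B))
         (φ : LatticeMap L L′) where
  private
    module L  = BoundedDistributiveLattice L
    module L′ = BoundedDistributiveLattice L′
    module B  = BooleanAlgebra B
    module φ  = LatticeMap φ
    S′ = graphSetoid L′ B
    module E′ = EntailmentRelation (latticeMaps L′ B fin)
    open FiniteSubsets S′ using (_≋_)

  inducedFunc : Func (graphSetoid L B) S′
  inducedFunc = record
    { to   = λ (x , a) → φ.to x , a
    ; cong = λ (p , q) → φ.⟦⟧-cong p , q
    }

  private
    f = Func.to inducedFunc

    ≋-refl : ∀ {X} → X ≋ X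
    ≋-refl = (λ p → p) , (λ p → p)

    [_]-cong : ∀ {x y a} → x L′.≈ y → [ (x , a) ] ≋ [ (y , a) ]
    [ p ]-cong = step p , step (L′.sym p)
      where
      open FiniteSubsets S′ using (_⊆_)
      step : ∀ {x y a} → x L′.≈ y → [ (x , a) ] ⊆ [ (y , a) ]
      step p (here (q , r)) = here (L′.trans q p , r)

    axioms-hold : ∀ {X Y} → LatticeMapAxiom L B fin X Y → map f X E′.⊢ map f Y
    axioms-hold (ax-s x a≉a′)    = axiom (ax-s (φ.to x) a≉a′)
    axioms-hold (ax-∧ x y a a′)  = resp ≋-refl [ L′.sym (φ.∧-homo x y) ]-cong
      (axiom (ax-∧ (φ.to x) (φ.to y) a a′))
    axioms-hold (ax-∨ x y a a′)  = resp ≋-refl [ L′.sym (φ.∨-homo x y) ]-cong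
      (axiom (ax-∨ (φ.to x) (φ.to y) a a′))
    axioms-hold ax-0             = resp ≋-refl [ L′.sym φ.⊥-homo ]-cong (axiom ax-0)
    axioms-hold ax-1             = resp ≋-refl [ L′.sym φ.⊤-homo ]-cong (axiom ax-1)
    axioms-hold (ax-t x)         =
      ≡.subst ([] E′.⊢_) (≡.sym (map-tabulate (λ i → x , Surjection.to (proj₂ fin) i) f))
        (axiom (ax-t (φ.to x)))

  inducedInterpretation : Interpretation (latticeMaps L B fin) (latticeMaps L′ B fin)
  inducedInterpretation = record
    { func      = inducedFunc
    ; preserves = generated-least (graphSetoid L B) (LatticeMapAxiom L B fin)
                    (pullback inducedFunc (latticeMaps L′ B fin)) axioms-hold
    }

{-# OPTIONS --safe #-}
-- A finite discrete Boolean algebra B is a power of the two-element one, so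
-- a lattice map g : L → B is a finite family of lattice maps gᵢ : L → 2.  A
-- partial description of such a family is a family of pairs (uᵢ , vᵢ) in
-- L × L, read as gᵢ(uᵢ) = 1 and gᵢ(vᵢ) = 0; it is contradictory as soon as
-- uᵢ ≤ vᵢ for some i.  Then X ⊢ Y holds iff every description that forces
-- all of X and refutes all of Y is contradictory.  This criterion mentions
-- nothing of L but its order, which φ both preserves and reflects.
module Submission where

open import Defs
open import Level using (Level; _⊔_)
open import Algebra.Lattice.Bundles using (BooleanAlgebra)
import Algebra.Lattice.Properties.BooleanAlgebra as BooleanAlgebraProperties
import Algebra.Lattice.Properties.DistributiveLattice as DistributiveLatticeProperties
open import Data.Bool.Base as Bool using (Bool; true; false; not; if_then_else_)
open import Data.Bool.Properties as Bool using (not-¬; ¬-not)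
open import Data.Fin.Base using (Fin; zero; suc)
open import Data.Fin.Properties as Fin using (¬∀⟶∃¬)
open import Data.List.Base using (List; []; _∷_; [_]; _++_; map; tabulate; length; lookup; foldr)
import Data.List.Membership.Setoid as Membership
open import Data.List.Membership.Propositional.Properties using (∈-lookup)
import Data.List.Membership.Setoid.Properties as Membershipₚ
open import Data.List.Relation.Binary.Subset.Setoid.Properties using (All-resp-⊇)
open import Data.List.Relation.Unary.All as All using (All; []; _∷_)
import Data.List.Relation.Unary.All.Properties as All
open import Data.List.Relation.Unary.AllPairs as AllPairs using (AllPairs; []; _∷_)
import Data.List.Relation.Unary.AllPairs.Properties as AllPairs
open import Data.List.Relation.Unary.Any using (here; there; index)
open import Data.List.Relation.Unary.Any.Properties using (lookup-index)
open import Data.Nat.Base using (ℕ; zero; suc)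
open import Data.Product.Base as Product using (∃-syntax; _×_; _,_; proj₁; proj₂)
open import Data.Sum.Base using (_⊎_; inj₁; inj₂; [_,_]′)
open import Data.Vec.Functional as Vector using (Vector; updateAt)
open import Data.Vec.Functional.Properties using (updateAt-updates; updateAt-minimal)
open import Function.Base using (_∘_; id)
open import Function.Bundles using (Surjection; mk⇔)
open import Function.Definitions using (Injective)
open import Relation.Binary.Bundles using (Setoid)
open import Relation.Binary.Definitions using (Decidable; Symmetric)
import Relation.Binary.Lattice.Bundles as Order
open import Relation.Binary.PropositionalEquality as ≡ using (_≡_; _≢_; _≗_)
open import Relation.Nullary using (¬_; yes; no; does; contradiction)
open import Relation.Nullary.Decidable using (does-⇔; dec-true; dec-false; _×-dec_; _⊎-dec_)

private
  variable
    a b c c′ ℓ ℓ′ β r : Level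

-- The order of a bounded distributive lattice.

module BoundedDistributiveLatticeProperties (L : BoundedDistributiveLattice c ℓ) where
  open BoundedDistributiveLattice L
  open DistributiveLatticeProperties distributiveLattice
    using (∨-∧-orderTheoreticLattice)
  open Order.Lattice ∨-∧-orderTheoreticLattice public
    using (_≤_; x≤x∨y; y≤x∨y; ∨-least; x∧y≤x; x∧y≤y; ∧-greatest)
    renaming ( refl to ≤-refl; reflexive to ≤-reflexive
             ; trans to ≤-trans; antisym to ≤-antisym )

  ⊥≤x : ∀ x → ⊥ ≤ x
  ⊥≤x x = ≤-trans (x≤x∨y ⊥ x) (≤-reflexive (proj₁ ∨-identity x))

  x≤⊤ : ∀ x → x ≤ ⊤
  -- `x ≤ y` unfolds to the equation `x ≈ x ∧ y`.
  x≤⊤ x = sym (proj₂ ∧-identity x)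

  ∧-monoˡ-≤ : ∀ {x y} z → x ≤ y → x ∧ z ≤ y ∧ z
  ∧-monoˡ-≤ z x≤y = ∧-greatest (≤-trans (x∧y≤x _ z) x≤y) (x∧y≤y _ z)

  ∧-swap-≤ : ∀ x y → x ∧ y ≤ y ∧ x
  ∧-swap-≤ x y = ≤-reflexive (∧-comm x y)

  ≤-cases : ∀ {u x y z} → u ≤ x ∨ y → u ∧ x ≤ z → u ∧ y ≤ z → u ≤ z
  ≤-cases {u} {x} {y} u≤x∨y p q =
    ≤-trans (∧-greatest ≤-refl u≤x∨y)
      (≤-trans (≤-reflexive (∧-distribˡ-∨ u x y)) (∨-least p q))

  -- Distributing `u` over `v ∨ x` gives two pieces, both below `v`. This becomes the cut rule for a
  -- single coordinate.
  ≤-cut : ∀ {u v x} → u ∧ x ≤ v → u ≤ v ∨ x → u ≤ v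
  ≤-cut {u} {v} p q = ≤-cases q (x∧y≤y u v) p

-- Finite discrete Boolean algebras as powers of the two-element one.

AllPairs-lookup : ∀ {A : Set a} {R : A → A → Set r} → Symmetric R →
                  ∀ {xs} → AllPairs R xs →
                  ∀ {i j} → i ≢ j → R (lookup xs i) (lookup xs j)
AllPairs-lookup R-sym (_ ∷ _)    {zero}  {zero}  i≢j = contradiction ≡.refl i≢j
AllPairs-lookup R-sym (rs ∷ _)   {zero}  {suc j} _   = All.lookup rs (∈-lookup j)
AllPairs-lookup R-sym (rs ∷ _)   {suc i} {zero}  _   = R-sym (All.lookup rs (∈-lookup i))
AllPairs-lookup R-sym (_ ∷ rss)  {suc i} {suc j} i≢j =
  AllPairs-lookup R-sym rss (i≢j ∘ ≡.cong suc)

-- An isomorphism of B with the algebra of functions Fin dim → Bool.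
record Coordinates (B : BooleanAlgebra b β) : Set (b ⊔ β) where
  open BooleanAlgebra B
  field
    dim       : ℕ
    χ         : Carrier → Fin dim → Bool
    cong      : ∀ {x y} → x ≈ y → χ x ≗ χ y
    injective : ∀ {x y} → χ x ≗ χ y → x ≈ y
    surjective : ∀ s → ∃[ x ] χ x ≗ s
    ∧-homo    : ∀ x y i → χ (x ∧ y) i ≡ χ x i Bool.∧ χ y i
    ∨-homo    : ∀ x y i → χ (x ∨ y) i ≡ χ x i Bool.∨ χ y i
    ⊤-homo    : ∀ i → χ ⊤ i ≡ true
    ⊥-homo    : ∀ i → χ ⊥ i ≡ false

  -- Equality in `Bool` is decidable and there are finitely many coordinates, so a search turns the
  -- negation into an actual index.
  separated : ∀ {x y} → x ≉ y → ∃[ i ] χ x i ≢ χ y i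
  separated {x} {y} x≉y =
    ¬∀⟶∃¬ dim _ (λ i → χ x i Bool.≟ χ y i) (x≉y ∘ injective)

module FiniteBooleanAlgebra (B : BooleanAlgebra b β)
                            (_≟_ : Discrete (BooleanAlgebra.setoid B)) where
  open BooleanAlgebra B renaming (¬_ to infix 8 ∁_)
  private
    boundedDistributiveLattice : BoundedDistributiveLattice _ _
    boundedDistributiveLattice = record
      { isDistributiveLattice = isDistributiveLattice
      ; ∧-identity = BooleanAlgebraProperties.∧-identity B
      ; ∨-identity = BooleanAlgebraProperties.∨-identity B
      }
  open BoundedDistributiveLatticeProperties boundedDistributiveLattice
  open Membership setoid using (_∈_)

  _≤?_ : Decidable _≤_
  x ≤? y = x ≟ (x ∧ y)

  Disjoint : Carrier → Carrier → Set β
  Disjoint x y = x ∧ y ≤ ⊥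

  Disjoint-sym : Symmetric Disjoint
  Disjoint-sym {x} {y} = ≤-trans (∧-swap-≤ y x)

  Disjoint-anti : ∀ {x x′ y y′} → x′ ≤ x → y′ ≤ y → Disjoint x y → Disjoint x′ y′
  Disjoint-anti {x′ = x′} {y′ = y′} x′≤x y′≤y =
    ≤-trans (∧-greatest (≤-trans (x∧y≤x x′ y′) x′≤x) (≤-trans (x∧y≤y x′ y′) y′≤y))

  -- The nonzero elements among d ∧ ⋀ᵢ ±bᵢ, for bs = b₁ , … , bₙ and all
  -- choices of signs.
  parts : List Carrier → Carrier → List Carrier
  parts []       d with d ≤? ⊥
  ... | yes _ = []
  ... | no _  = [ d ]
  parts (b ∷ bs) d = parts bs (d ∧ b) ++ parts bs (d ∧ ∁ b)

  parts-≤ : ∀ bs d → All (_≤ d) (parts bs d)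
  parts-≤ []       d with d ≤? ⊥
  ... | yes _ = []
  ... | no _  = ≤-refl ∷ []
  parts-≤ (b ∷ bs) d = All.++⁺
    (All.map (λ p → ≤-trans p (x∧y≤x d b)) (parts-≤ bs (d ∧ b)))
    (All.map (λ p → ≤-trans p (x∧y≤x d (∁ b))) (parts-≤ bs (d ∧ ∁ b)))

  parts-nonzero : ∀ bs d → All (λ p → ¬ (p ≤ ⊥)) (parts bs d)
  parts-nonzero []       d with d ≤? ⊥
  ... | yes _  = []
  ... | no d≰⊥ = d≰⊥ ∷ []
  parts-nonzero (b ∷ bs) d =
    All.++⁺ (parts-nonzero bs (d ∧ b)) (parts-nonzero bs (d ∧ ∁ b))

  complement-disjoint : ∀ x → Disjoint x (∁ x)
  complement-disjoint x = ≤-reflexive (∧-complementʳ x)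

  parts-disjoint : ∀ bs d → AllPairs Disjoint (parts bs d)
  parts-disjoint []       d with d ≤? ⊥
  ... | yes _ = []
  ... | no _  = [] ∷ []
  parts-disjoint (b ∷ bs) d =
    AllPairs.++⁺ (parts-disjoint bs (d ∧ b)) (parts-disjoint bs (d ∧ ∁ b))
      (All.map (λ p → All.map (λ q → Disjoint-anti
                   (≤-trans p (x∧y≤y d b)) (≤-trans q (x∧y≤y d (∁ b)))
                   (complement-disjoint b))
                 (parts-≤ bs (d ∧ ∁ b)))
               (parts-≤ bs (d ∧ b)))

  Decides : Carrier → Carrier → Set β
  Decides x p = p ≤ x ⊎ Disjoint p x

  -- When the recursion meets `x` in the list, it puts every later piece below `x` or below its
  -- complement; further cutting only shrinks the pieces.
  parts-decide : ∀ bs d {x} → x ∈ bs → All (Decides x) (parts bs d)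
  parts-decide (b ∷ bs) d {x} (here x≈b) = All.++⁺
    (All.map (λ p → inj₁ (≤-trans p (≤-trans (x∧y≤y d b) (≤-reflexive (sym x≈b)))))
             (parts-≤ bs (d ∧ b)))
    (All.map (λ p → inj₂ (Disjoint-anti (≤-trans p (x∧y≤y d (∁ b))) (≤-reflexive x≈b)
                            (Disjoint-sym (complement-disjoint b))))
             (parts-≤ bs (d ∧ ∁ b)))
  parts-decide (b ∷ bs) d (there x∈bs) =
    All.++⁺ (parts-decide bs (d ∧ b) x∈bs) (parts-decide bs (d ∧ ∁ b) x∈bs)

  -- This expresses that `d` is the join of its parts without forming that join. Each cut splits `d`
  -- along `b ∨ ∁ b`, and a discarded piece is zero, hence below anything.
  parts-cover : ∀ bs d {x y} → All (λ p → p ∧ x ≤ y) (parts bs d) → d ∧ x ≤ y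
  parts-cover []       d {x} {y} ps with d ≤? ⊥
  ... | yes d≤⊥ = ≤-trans (x∧y≤x d x) (≤-trans d≤⊥ (⊥≤x y))
  ... | no _    = All.head ps
  parts-cover (b ∷ bs) d {x} ps = ≤-cases
    (≤-trans (x≤⊤ _) (≤-reflexive (sym (∨-complementʳ b))))
    (≤-trans (rearrange b) (parts-cover bs (d ∧ b) (All.++⁻ˡ (parts bs (d ∧ b)) ps)))
    (≤-trans (rearrange (∁ b)) (parts-cover bs (d ∧ ∁ b) (All.++⁻ʳ (parts bs (d ∧ b)) ps)))
    where
    rearrange : ∀ e → (d ∧ x) ∧ e ≤ (d ∧ e) ∧ x
    rearrange e = ∧-greatest (∧-monoˡ-≤ e (x∧y≤x d x)) (≤-trans (x∧y≤x _ e) (x∧y≤y d x))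

  ⋁ : ∀ {n} → Vector Carrier n → Carrier
  ⋁ = Vector.foldr _∨_ ⊥

  ≤-⋁ : ∀ {n} (t : Vector Carrier n) i → t i ≤ ⋁ t
  ≤-⋁ t zero    = x≤x∨y (t zero) _
  ≤-⋁ t (suc i) = ≤-trans (≤-⋁ (t ∘ suc) i) (y≤x∨y (t zero) _)

  ⋁-disjoint : ∀ {n} (t : Vector Carrier n) {p} →
               (∀ i → Disjoint p (t i)) → Disjoint p (⋁ t)
  ⋁-disjoint {zero}  t {p} _ = x∧y≤y p ⊥
  ⋁-disjoint {suc n} t {p} h = ≤-cases (x∧y≤y p _)
    (≤-trans (∧-monoˡ-≤ (t zero) (x∧y≤x p _)) (h zero))
    (≤-trans (∧-monoˡ-≤ (⋁ (t ∘ suc)) (x∧y≤x p _)) (⋁-disjoint (t ∘ suc) (h ∘ suc)))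

  -- Cutting `⊤` by every element of B leaves nonzero pieces that each element either contains or
  -- misses: the atoms. The coordinates of `x` record which atoms lie below it.
  coordinates : Finite setoid → Coordinates B
  coordinates (n , enum) = record
    { dim        = length atoms
    ; χ          = χ
    ; cong       = λ x≈y i → does-⇔
        (mk⇔ (λ p → ≤-trans p (≤-reflexive x≈y)) (λ p → ≤-trans p (≤-reflexive (sym x≈y))))
        (atom i ≤? _) (atom i ≤? _)
    ; injective  = λ e → ≤-antisym (χ-reflects-≤ e) (χ-reflects-≤ (≡.sym ∘ e))
    ; surjective = λ s → ⋁ (select s) , χ-⋁ s
    ; ∧-homo     = λ x y i → does-⇔
        (mk⇔ (λ p → ≤-trans p (x∧y≤x x y) , ≤-trans p (x∧y≤y x y))
             (λ (p , q) → ∧-greatest p q))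
        (atom i ≤? _) ((atom i ≤? _) ×-dec (atom i ≤? _))
    ; ∨-homo     = λ x y i → does-⇔
        (mk⇔ (atom-prime i) [ (λ p → ≤-trans p (x≤x∨y x y)) , (λ p → ≤-trans p (y≤x∨y x y)) ]′)
        (atom i ≤? _) ((atom i ≤? _) ⊎-dec (atom i ≤? _))
    ; ⊤-homo     = λ i → dec-true (atom i ≤? ⊤) (x≤⊤ _)
    ; ⊥-homo     = λ i → dec-false (atom i ≤? ⊥) (nonzero i)
    }
    where
    open Surjection enum using (to; strictlySurjective)

    elements = tabulate to

    ∈-elements : ∀ x → x ∈ elements
    ∈-elements x with strictlySurjective x
    ... | i , to[i]≈x =
      Membershipₚ.∈-resp-≈ setoid to[i]≈x (Membershipₚ.∈-tabulate⁺ setoid i)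

    atoms = parts elements ⊤

    atom : Fin (length atoms) → Carrier
    atom = lookup atoms

    nonzero : ∀ i → ¬ (atom i ≤ ⊥)
    nonzero i = All.lookup (parts-nonzero elements ⊤) (∈-lookup i)

    decide : ∀ i x → Decides x (atom i)
    decide i x = All.lookup (parts-decide elements ⊤ (∈-elements x)) (∈-lookup i)

    disjoint⇒≰ : ∀ i {x} → Disjoint (atom i) x → ¬ (atom i ≤ x)
    disjoint⇒≰ i d p = nonzero i (≤-trans (∧-greatest ≤-refl p) d)

    atom-prime : ∀ i {x y} → atom i ≤ x ∨ y → atom i ≤ x ⊎ atom i ≤ y
    atom-prime i {x} {y} p with decide i x | decide i y
    ... | inj₁ q | _      = inj₁ q
    ... | inj₂ _ | inj₁ q = inj₂ q
    ... | inj₂ d | inj₂ e = contradiction (≤-cases p d e) (nonzero i)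

    χ : Carrier → Fin (length atoms) → Bool
    χ x i = does (atom i ≤? x)

    -- By `parts-cover` it is enough to compare `x` with `y` on each atom.
    χ-reflects-≤ : ∀ {x y} → χ x ≗ χ y → x ≤ y
    χ-reflects-≤ {x} {y} e = ≤-trans (∧-greatest (x≤⊤ x) ≤-refl)
      (parts-cover elements ⊤ (All.tabulate λ p∈atoms →
        ≡.subst (λ p → p ∧ x ≤ y) (≡.sym (lookup-index p∈atoms)) (below (index p∈atoms))))
      where
      below : ∀ i → atom i ∧ x ≤ y
      -- An atom below `x` but not below `y` needs no clause: `e i` would equate `true` with
      -- `false`.
      below i with decide i x | atom i ≤? x | atom i ≤? y | e i
      ... | inj₂ d | _       | _     | _  = ≤-trans d (⊥≤x y)
      ... | inj₁ p | no ¬p   | _     | _  = contradiction p ¬p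
      ... | inj₁ _ | yes _   | yes q | _  = ≤-trans (x∧y≤x _ x) q

    select : (Fin (length atoms) → Bool) → Vector Carrier (length atoms)
    select s j = if s j then atom j else ⊥

    -- An atom that is not selected is disjoint from every selected one, hence from their join;
    -- being nonzero, it does not lie below that join.
    χ-⋁ : ∀ s → χ (⋁ (select s)) ≗ s
    χ-⋁ s i with s i in eq
    ... | true  = dec-true (atom i ≤? _) (≤-trans selected (≤-⋁ (select s) i))
      where
      selected : atom i ≤ select s i
      selected rewrite eq = ≤-refl
    ... | false = dec-false (atom i ≤? _)
                    (disjoint⇒≰ i (⋁-disjoint (select s) unselected))
      where
      unselected : ∀ j → Disjoint (atom i) (select s j)
      unselected j with s j in eq′
      ... | false = x∧y≤y (atom i) ⊥
      ... | true  = AllPairs-lookup Disjoint-sym (parts-disjoint elements ⊤)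
                      λ { ≡.refl → contradiction (≡.trans (≡.sym eq′) eq) λ () }

-- Derived rules of entailment relations.

module EntailmentProperties {S : Setoid c ℓ} (E : EntailmentRelation S r) where
  private module E = EntailmentRelation E
  open E using (_⊢_)
  open FiniteSubsets S
  open Membershipₚ using (∈-++⁺ˡ; ∈-++⁺ʳ; ∈-++⁻)

  -- Rule `M` only appends, but for `Z ⊆ Z′` the lists `Z ++ Z′` and `Z′` denote the same finite
  -- subset.
  weaken : ∀ {X X′ Y Y′} → X ⊆ X′ → Y ⊆ Y′ → X ⊢ Y → X′ ⊢ Y′
  weaken X⊆X′ Y⊆Y′ d = E.resp (absorb X⊆X′) (absorb Y⊆Y′) (E.M _ _ d)
    where
    absorb : ∀ {Z Z′} → Z ⊆ Z′ → Z ++ Z′ ≋ Z′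
    absorb {Z} Z⊆Z′ = (λ p → [ Z⊆Z′ , id ]′ (∈-++⁻ S Z p)) , ∈-++⁺ʳ S Z

  weakenˡ : ∀ {X Y} x → X ⊢ Y → x ∷ X ⊢ Y
  weakenˡ x = weaken there id

  -- Iterated `T`. With axiom (t) it becomes a case distinction on the value of a lattice element.
  cut-list : ∀ Z {X Y} → X ⊢ Z ++ Y → (∀ {z} → z ∈ Z → z ∷ X ⊢ Y) → X ⊢ Y
  cut-list []      d es = d
  cut-list (z ∷ Z) d es =
    cut-list Z (E.T z d (weaken id (∈-++⁺ʳ S Z) (es (here (Setoid.refl S))))) (es ∘ there)

  cut₂ : ∀ {X Y x y} → X ⊢ [ x ] → X ⊢ [ y ] → x ∷ y ∷ [] ⊢ Y → X ⊢ Y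
  cut₂ {X} {Y} {x} {y} d e f = E.T x (weaken id singleton d)
    (E.T y (weaken there singleton e)
      (weaken (λ { (here p) → there (here p) ; (there (here p)) → here p }) id f))
    where
    singleton : ∀ {z} → [ z ] ⊆ z ∷ Y
    singleton (here p) = here p

-- Constraints in a single coordinate.

-- The Boolean s in the literal (s , x) is the value that x is to take.
module Literals (L : BoundedDistributiveLattice c ℓ) where
  open BoundedDistributiveLattice L
  open BoundedDistributiveLatticeProperties L

  Constraint : Set c
  Constraint = Carrier × Carrier

  Contradictory : Constraint → Set ℓ
  Contradictory (u , v) = u ≤ v

  -- Sufficient by monotonicity of lattice maps. Given both halves of the constraint, the weaker
  -- `u ≤ v ∨ x` and `u ∧ x ≤ v` would also fix the value, but the stricter form holds after
  -- `assume`.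
  Forces : Bool → Carrier → Constraint → Set ℓ
  Forces true  x (u , v) = u ≤ x
  Forces false x (u , v) = x ≤ v

  -- One pair still suffices: `u` and `x` both go to 1 iff `u ∧ x` does, and `v` and `x` both go to
  -- 0 iff `v ∨ x` does.
  assume : Bool → Carrier → Constraint → Constraint
  assume true  x (u , v) = u ∧ x , v
  assume false x (u , v) = u , v ∨ x

  forces-resp : ∀ s {x y} g → x ≈ y → Forces s x g → Forces s y g
  forces-resp true  g x≈y p = ≤-trans p (≤-reflexive x≈y)
  forces-resp false g x≈y p = ≤-trans (≤-reflexive (sym x≈y)) p

  forces-assumed : ∀ s x g → Forces s x (assume s x g)
  forces-assumed true  x (u , v) = x∧y≤y u x
  forces-assumed false x (u , v) = y≤x∨y v x

  forces-assume : ∀ s {x} t y g → Forces s x g → Forces s x (assume t y g)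
  forces-assume true  true  y (u , v) p = ≤-trans (x∧y≤x u y) p
  forces-assume true  false y (u , v) p = p
  forces-assume false true  y (u , v) p = p
  forces-assume false false y (u , v) p = ≤-trans p (x≤x∨y v y)

  contradiction-≢ : ∀ {s t x} g → s ≢ t → Forces s x g → Forces t x g → Contradictory g
  contradiction-≢ {true}  {true}  g s≢t p q = contradiction ≡.refl s≢t
  contradiction-≢ {true}  {false} g s≢t p q = ≤-trans p q
  contradiction-≢ {false} {true}  g s≢t p q = ≤-trans q p
  contradiction-≢ {false} {false} g s≢t p q = contradiction ≡.refl s≢t

  contradiction-not : ∀ s {x} g → Forces s x g → Forces (not s) x g → Contradictory g
  contradiction-not s g = contradiction-≢ {s} {not s} g (not-¬ ≡.refl)

  -- The two premises are `u ∧ x ≤ v` and `u ≤ v ∨ x`, so `≤-cut` applies; here distributivity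
  -- enters.
  contradictory-cut : ∀ s {x} g → Contradictory (assume s x g) →
                      Contradictory (assume (not s) x g) → Contradictory g
  contradictory-cut true  g p q = ≤-cut p q
  contradictory-cut false g p q = ≤-cut q p

  ∧-contradictory : ∀ s t {x y} g → Forces s x g → Forces t y g →
                    Forces (not (s Bool.∧ t)) (x ∧ y) g → Contradictory g
  ∧-contradictory true  true  g p q r = ≤-trans (∧-greatest p q) r
  ∧-contradictory true  false {x} {y} g p q r = ≤-trans r (≤-trans (x∧y≤y x y) q)
  ∧-contradictory false t     {x} {y} g p q r = ≤-trans r (≤-trans (x∧y≤x x y) p)

  ∨-contradictory : ∀ s t {x y} g → Forces s x g → Forces t y g →
                    Forces (not (s Bool.∨ t)) (x ∨ y) g → Contradictory g
  ∨-contradictory true  t     {x} {y} g p q r = ≤-trans p (≤-trans (x≤x∨y x y) r)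
  ∨-contradictory false true  {x} {y} g p q r = ≤-trans q (≤-trans (y≤x∨y x y) r)
  ∨-contradictory false false g p q r = ≤-trans r (∨-least p q)

-- The criterion as an entailment relation.

module Semantics (B : BooleanAlgebra b β) (coords : Coordinates B)
                 (L : BoundedDistributiveLattice c ℓ) where
  private
    module B = BooleanAlgebra B
    module χ = Coordinates coords
  open χ using (dim; χ)
  open BoundedDistributiveLattice L
  open BoundedDistributiveLatticeProperties L
  open Literals L public

  Description : Set c
  Description = Vector Constraint dim

  Inconsistent : Description → Set ℓ
  Inconsistent Γ = ∃[ i ] Contradictory (Γ i)

  infix 4 _⊨_ _⊭_ _⊩_

  _⊨_ : Description → Carrier × B.Carrier → Set ℓ
  Γ ⊨ (x , a) = ∀ i → Forces (χ a i) x (Γ i)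

  -- Refutation is positive: a value of `x` other than `a` is witnessed by a coordinate at which the
  -- opposite Boolean is forced.
  _⊭_ : Description → Carrier × B.Carrier → Set ℓ
  Γ ⊭ (x , a) = ∃[ i ] Forces (not (χ a i)) x (Γ i)

  _⊩_ : List (Carrier × B.Carrier) → List (Carrier × B.Carrier) → Set (c ⊔ ℓ ⊔ b)
  X ⊩ Y = ∀ Γ → All (Γ ⊨_) X → All (Γ ⊭_) Y → Inconsistent Γ

  assume-all : Carrier × B.Carrier → Description → Description
  assume-all (x , a) Γ i = assume (χ a i) x (Γ i)

  ⊨-assumed : ∀ z Γ → assume-all z Γ ⊨ z
  ⊨-assumed (x , a) Γ i = forces-assumed (χ a i) x (Γ i)

  ⊨-assume-all : ∀ z {w} Γ → Γ ⊨ w → assume-all z Γ ⊨ w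
  ⊨-assume-all (x , a) {_ , b} Γ Γ⊨w i =
    forces-assume (χ b i) (χ a i) x (Γ i) (Γ⊨w i)

  -- The description built from X alone. It starts from `(⊤ , ⊥)`, which every lattice map
  -- satisfies; coordinate `i` then collects in a meet the elements with value 1 there and in a join
  -- those with value 0.
  describe : List (Carrier × B.Carrier) → Description
  describe = foldr assume-all (λ _ → ⊤ , ⊥)

  describe-⊨ : ∀ X → All (describe X ⊨_) X
  describe-⊨ []      = []
  describe-⊨ (z ∷ X) = ⊨-assumed z (describe X) ∷
    All.map (λ {w} → ⊨-assume-all z {w} (describe X)) (describe-⊨ X)

  ⊨⇒⊭ : ∀ {x a a′} Γ → a B.≉ a′ → Γ ⊨ (x , a) → Γ ⊭ (x , a′)
  ⊨⇒⊭ {x} {a} {a′} Γ a≉a′ Γ⊨ with χ.separated a≉a′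
  ... | i , ne = i , ≡.subst (λ s → Forces s x (Γ i)) (¬-not ne) (Γ⊨ i)

  ⊨-⊭-inconsistent : ∀ {z} Γ → Γ ⊨ z → Γ ⊭ z → Inconsistent Γ
  ⊨-⊭-inconsistent {x , a} Γ Γ⊨z (i , p) =
    i , contradiction-not (χ a i) (Γ i) (Γ⊨z i) p

  ⊨-resp : ∀ {Γ z w} → Setoid._≈_ (graphSetoid L B) z w → Γ ⊨ z → Γ ⊨ w
  ⊨-resp {Γ} {x , a} (x≈y , a≈b) Γ⊨z i =
    ≡.subst (λ s → Forces s _ (Γ i)) (χ.cong a≈b i)
      (forces-resp (χ a i) (Γ i) x≈y (Γ⊨z i))

  ⊭-resp : ∀ {Γ z w} → Setoid._≈_ (graphSetoid L B) z w → Γ ⊭ z → Γ ⊭ w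
  ⊭-resp {Γ} {x , a} (x≈y , a≈b) (i , p) = i ,
    ≡.subst (λ s → Forces s _ (Γ i)) (≡.cong not (χ.cong a≈b i))
      (forces-resp (not (χ a i)) (Γ i) x≈y p)

  -- With x assumed to have value a (in all coordinates at once) some
  -- coordinate i becomes contradictory; it suffices to cut at that i.
  ⊩-cut : ∀ {X Y} z → X ⊩ (z ∷ Y) → (z ∷ X) ⊩ Y → X ⊩ Y
  ⊩-cut {X} {Y} z@(x , a) d e Γ Γ⊨X Γ⊭Y
    with e (assume-all z Γ)
           (⊨-assumed z Γ ∷ All.map (λ {w} → ⊨-assume-all z {w} Γ) Γ⊨X)
           (All.map (λ {w} → ⊭-assume-all {w}) Γ⊭Y)
    where
    ⊭-assume-all : ∀ {w} → Γ ⊭ w → assume-all z Γ ⊭ w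
    ⊭-assume-all {_ , b} (i , p) = i , forces-assume (not (χ b i)) (χ a i) x (Γ i) p
  ... | i , p with d Γ′ (All.map (λ {w} → Γ′⊨ {w}) Γ⊨X)
                        (refuted ∷ All.map (λ {w} → Γ′⊭ {w}) Γ⊭Y)
    where
    g′ = assume (not (χ a i)) x
    Γ′ = updateAt Γ i g′

    Γ′-forces : ∀ s {y} j → Forces s y (Γ j) → Forces s y (Γ′ j)
    Γ′-forces s j q with j Fin.≟ i
    ... | yes ≡.refl rewrite updateAt-updates i {g′} Γ =
      forces-assume s (not (χ a i)) x (Γ i) q
    ... | no j≢i rewrite updateAt-minimal j i {g′} Γ j≢i = q

    Γ′⊨ : ∀ {w} → Γ ⊨ w → Γ′ ⊨ w
    Γ′⊨ {_ , b} Γ⊨w j = Γ′-forces (χ b j) j (Γ⊨w j)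

    Γ′⊭ : ∀ {w} → Γ ⊭ w → Γ′ ⊭ w
    Γ′⊭ {_ , b} (j , q) = j , Γ′-forces (not (χ b j)) j q

    refuted : Γ′ ⊭ z
    refuted = i , ≡.subst (Forces (not (χ a i)) x) (≡.sym (updateAt-updates i Γ))
                    (forces-assumed (not (χ a i)) x (Γ i))
  -- `Γ′` differs from `Γ` only at `i`: a contradiction elsewhere was already in `Γ`, and one at `i`
  -- combines with `p`.
  ... | j , q with j Fin.≟ i
  ... | yes ≡.refl rewrite updateAt-updates i {assume (not (χ a i)) x} Γ =
    i , contradictory-cut (χ a i) (Γ i) p q
  ... | no j≢i rewrite updateAt-minimal j i {assume (not (χ a i)) x} Γ j≢i = j , q

  ⊩-isEntailmentRelation : IsEntailmentRelation (graphSetoid L B) _⊩_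
  ⊩-isEntailmentRelation = record
    { resp = λ (X⊆X′ , _) (Y⊆Y′ , _) d Γ Γ⊨X′ Γ⊭Y′ →
        d Γ (All-resp-⊇ S (λ {z} {w} → ⊨-resp {Γ} {z} {w}) X⊆X′ Γ⊨X′)
            (All-resp-⊇ S (λ {z} {w} → ⊭-resp {Γ} {z} {w}) Y⊆Y′ Γ⊭Y′)
    ; R    = λ {_} {_} {z} z∈X z∈Y Γ Γ⊨X Γ⊭Y → ⊨-⊭-inconsistent {z} Γ
        (All.lookupₛ S (λ {z} {w} → ⊨-resp {Γ} {z} {w}) Γ⊨X z∈X)
        (All.lookupₛ S (λ {z} {w} → ⊭-resp {Γ} {z} {w}) Γ⊭Y z∈Y)
    ; M    = λ {X} {Y} _ _ d Γ Γ⊨X Γ⊭Y → d Γ (All.++⁻ˡ X Γ⊨X) (All.++⁻ˡ Y Γ⊭Y)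
    ; T    = ⊩-cut
    }
    where S = graphSetoid L B

-- Soundness and completeness of the criterion.

-- Choosing for each i the value s i that makes P i or Q i fail is not an
-- option, as P and Q need not be decidable.
common-index : ∀ {n p g} {P Q : Fin n → Set p} {G : Set g} →
               (∀ {i} → P i → Q i → G) →
               (∀ (s : Fin n → Bool) → G ⊎ ∃[ i ] (if s i then P i else Q i)) → G
common-index {zero}  _   w with w (λ ())
... | inj₁ g = g
common-index {suc n} {P = P} {Q} {G} meet w = common-index meet w′
  where
  w′ : ∀ s → G ⊎ ∃[ i ] (if s i then P (suc i) else Q (suc i))
  w′ s with w (true Vector.∷ s) | w (false Vector.∷ s)
  ... | inj₁ g           | _                = inj₁ g
  ... | inj₂ (suc i , e) | _                = inj₂ (i , e)
  ... | inj₂ (zero , _)  | inj₁ g           = inj₁ g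
  ... | inj₂ (zero , _)  | inj₂ (suc i , e) = inj₂ (i , e)
  -- Both choices at index zero have now been answered there, so `P` and `Q` meet; every other case
  -- already yields `G` or an index in the tail.
  ... | inj₂ (zero , p)  | inj₂ (zero , q)  = inj₁ (meet p q)

module LatticeMaps (B : BooleanAlgebra b β) (fin : Finite (BooleanAlgebra.setoid B))
                   (coords : Coordinates B) (L : BoundedDistributiveLattice c ℓ) where
  private
    module B = BooleanAlgebra B
    module χ = Coordinates coords
  open χ using (χ)
  open Surjection (proj₂ fin) using (to; strictlySurjective)
  open BoundedDistributiveLattice L
  open BoundedDistributiveLatticeProperties L
  open Semantics B coords L
  open EntailmentRelation (latticeMaps L B fin) using (_⊢_)
  open EntailmentProperties (latticeMaps L B fin)

  axiom-sound : ∀ {X Y} → LatticeMapAxiom L B fin X Y → X ⊩ Y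
  axiom-sound (ax-s x a≉a′) Γ (p ∷ q ∷ []) [] with χ.separated a≉a′
  ... | i , ne = i , contradiction-≢ (Γ i) ne (p i) (q i)
  axiom-sound (ax-∧ x y a a′) Γ (p ∷ q ∷ []) ((i , r) ∷ []) =
    i , ∧-contradictory (χ a i) (χ a′ i) (Γ i) (p i) (q i)
          (≡.subst (λ s → Forces (not s) (x ∧ y) (Γ i)) (χ.∧-homo a a′ i) r)
  axiom-sound (ax-∨ x y a a′) Γ (p ∷ q ∷ []) ((i , r) ∷ []) =
    i , ∨-contradictory (χ a i) (χ a′ i) (Γ i) (p i) (q i)
          (≡.subst (λ s → Forces (not s) (x ∨ y) (Γ i)) (χ.∨-homo a a′ i) r)
  axiom-sound ax-0 Γ [] ((i , r) ∷ []) rewrite χ.⊥-homo i =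
    i , ≤-trans r (⊥≤x _)
  axiom-sound ax-1 Γ [] ((i , r) ∷ []) rewrite χ.⊤-homo i =
    i , ≤-trans (x≤⊤ _) r
  -- Each Boolean vector `s` is the coordinate vector of some element of B, and `Γ` refutes that
  -- value of `x` at some coordinate. By `common-index` a single coordinate then forces `x` both to
  -- 0 and to 1.
  axiom-sound (ax-t x) Γ [] refuted = common-index
    {P = λ i → Forces false x (Γ i)} {Q = λ i → Forces true x (Γ i)}
    (λ {i} p q → i , ≤-trans q p) (inj₂ ∘ witness)
    where
    witness : ∀ s → ∃[ i ] (if s i then Forces false x (Γ i) else Forces true x (Γ i))
    witness s with χ.surjective s
    ... | a , χa≗s with strictlySurjective a
    ... | k , to[k]≈a with ⊭-resp {Γ} (refl , to[k]≈a) (All.tabulate⁻ refuted k)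
    ... | i , p = i , select (s i)
      (≡.subst (λ t → Forces (not t) x (Γ i)) (χa≗s i) p)
      where
      select : ∀ t → Forces (not t) x (Γ i) →
               if t then Forces false x (Γ i) else Forces true x (Γ i)
      select true  p = p
      select false p = p

  sound : ∀ {X Y} → X ⊢ Y → X ⊩ Y
  sound = generated-least _ _ ⊩-isEntailmentRelation axiom-sound

  -- A literal whose value is 1 at `i` is absorbed into the first component by (∧), any other into
  -- the second by (∨). The derived values are controlled at coordinate `i` only, which is enough to
  -- tell them apart.
  describe-derivable : ∀ X i → ∃[ a ] ∃[ a′ ] χ a i ≡ true × χ a′ i ≡ false ×
                       X ⊢ [ (proj₁ (describe X i) , a) ] ×
                       X ⊢ [ (proj₂ (describe X i) , a′) ]
  describe-derivable [] i =
    B.⊤ , B.⊥ , χ.⊤-homo i , χ.⊥-homo i , axiom ax-1 , axiom ax-0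
  describe-derivable ((x , a₀) ∷ X) i with describe-derivable X i | χ a₀ i in eq
  ... | a , a′ , e , e′ , d , d′ | true =
    a B.∧ a₀ , a′ ,
    ≡.trans (χ.∧-homo a a₀ i) (≡.cong₂ Bool._∧_ e eq) , e′ ,
    cut₂ (weakenˡ _ d) (R (here (Setoid.refl S)) (here (Setoid.refl S)))
      (axiom (ax-∧ _ x a a₀)) ,
    weakenˡ _ d′
    where S = graphSetoid L B
  ... | a , a′ , e , e′ , d , d′ | false =
    a , a′ B.∨ a₀ ,
    e , ≡.trans (χ.∨-homo a′ a₀ i) (≡.cong₂ Bool._∨_ e′ eq) ,
    weakenˡ _ d ,
    cut₂ (weakenˡ _ d′) (R (here (Setoid.refl S)) (here (Setoid.refl S)))
      (axiom (ax-∨ _ x a′ a₀))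
    where S = graphSetoid L B

  -- Inconsistency of `describe X` gives `u ≤ v` at some `i`. From X, `u` has a value `a` that is 1
  -- at `i`, and `v` a value `a′` that is 0 there. As `u` equals `u ∧ v`, it also has the value
  -- `a ∧ a′`, which clashes with `a` by (s).
  refute : ∀ {X} → X ⊩ [] → X ⊢ []
  refute {X} d with d (describe X) (describe-⊨ X) []
  ... | i , u≤v with describe-derivable X i
  ... | a , a′ , e , e′ , p , q = cut₂ p (cut₂ p q meet) (axiom (ax-s _ a≉a∧a′))
    where
    meet : (proj₁ (describe X i) , a) ∷ (proj₂ (describe X i) , a′) ∷ [] ⊢
           [ (proj₁ (describe X i) , a B.∧ a′) ]
    meet = weaken id (λ { (here (r , s)) → here (trans r (sym u≤v) , s) ; (there ()) })
      (axiom (ax-∧ _ _ a a′))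

    a≉a∧a′ : a B.≉ a B.∧ a′
    a≉a∧a′ a≈a∧a′ = contradiction
      (≡.trans (≡.sym e) (≡.trans (χ.cong a≈a∧a′ i)
        (≡.trans (χ.∧-homo a a′ i) (≡.cong₂ Bool._∧_ e e′))))
      λ ()

  complete : Discrete B.setoid → ∀ {X} Y → X ⊩ Y → X ⊢ Y
  complete _≟_ [] d = refute d
  complete _≟_ {X} ((y , b) ∷ Y) d =
    cut-list (tabulate λ k → y , to k) (M X ((y , b) ∷ Y) (axiom (ax-t y))) each
    where
    S = graphSetoid L B

    value : ∀ c → (y , c) ∷ X ⊢ (y , b) ∷ Y
    value c with c ≟ b
    ... | yes c≈b = R (here (Setoid.refl S)) (here (refl , c≈b))
    ... | no c≉b  = weaken id there (complete _≟_ Y λ Γ Γ⊨ Γ⊭Y →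
      d Γ (All.tail Γ⊨) (⊨⇒⊭ Γ c≉b (All.head Γ⊨) ∷ Γ⊭Y))

    each : ∀ {z} → Membership._∈_ S z (tabulate λ k → y , to k) → z ∷ X ⊢ (y , b) ∷ Y
    each z∈ with Membershipₚ.∈-tabulate⁻ S z∈
    ... | k , z≈ = resp (replace z≈ , replace (Setoid.sym S z≈)) (id , id) (value (to k))
      where
      replace : ∀ {z w Z} → Setoid._≈_ S z w → FiniteSubsets._⊆_ S (w ∷ Z) (z ∷ Z)
      replace z≈w (here p)  = here (Setoid.trans S p (Setoid.sym S z≈w))
      replace z≈w (there p) = there p

-- Transfer of the criterion along an injective lattice map.

module _ {L : BoundedDistributiveLattice c ℓ} {L′ : BoundedDistributiveLattice c′ ℓ′}
         (B : BooleanAlgebra b β) (coords : Coordinates B) (φ : LatticeMap L L′)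
         (φ-injective : Injective (BoundedDistributiveLattice._≈_ L)
                          (BoundedDistributiveLattice._≈_ L′) (LatticeMap.to φ)) where
  private
    module L = BoundedDistributiveLattice L
    module L′ = BoundedDistributiveLattice L′
    module L≤ = BoundedDistributiveLatticeProperties L
    module L≤′ = BoundedDistributiveLatticeProperties L′
    module ⊩ = Semantics B coords L
    module ⊩′ = Semantics B coords L′
    open LatticeMap φ

    f : L.Carrier × BooleanAlgebra.Carrier B → L′.Carrier × BooleanAlgebra.Carrier B
    f = Product.map₁ to

  ≤-preserved : ∀ {x y} → x L≤.≤ y → to x L≤′.≤ to y
  ≤-preserved x≤y = L′.trans (⟦⟧-cong x≤y) (∧-homo _ _)

  -- The order is equational, so injectivity of φ reflects it.
  ≤-reflected : ∀ {x y} → to x L≤′.≤ to y → x L≤.≤ y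
  ≤-reflected fx≤fy = φ-injective (L′.trans fx≤fy (L′.sym (∧-homo _ _)))

  -- A description over L is pushed forward along φ. Being forced, or refuted, is a matter of
  -- inequalities and survives; the contradiction found in L′ is an inequality between images and
  -- comes back by `≤-reflected`.
  ⊩-reflected : ∀ {X Y} → map f X ⊩′.⊩ map f Y → X ⊩.⊩ Y
  ⊩-reflected d Γ Γ⊨X Γ⊭Y =
    Product.map₂ ≤-reflected
      (d (Product.map to to ∘ Γ)
        (All.map⁺ (All.map (λ {z} → ⊨-image {z}) Γ⊨X))
        (All.map⁺ (All.map (λ {z} → ⊭-image {z}) Γ⊭Y)))
    where
    forces-image : ∀ s {x} i → ⊩.Forces s x (Γ i) →
                   ⊩′.Forces s (to x) (Product.map to to (Γ i))
    forces-image true  i = ≤-preserved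
    forces-image false i = ≤-preserved

    ⊨-image : ∀ {z} → Γ ⊩.⊨ z → Product.map to to ∘ Γ ⊩′.⊨ f z
    ⊨-image {_ , a} Γ⊨z i = forces-image (Coordinates.χ coords a i) i (Γ⊨z i)

    ⊭-image : ∀ {z} → Γ ⊩.⊭ z → Product.map to to ∘ Γ ⊩′.⊭ f z
    ⊭-image {_ , a} (i , p) = i , forces-image (not (Coordinates.χ coords a i)) i p

proposition3p16 : {c ℓ c′ ℓ′ b β : Level}
    (L : BoundedDistributiveLattice c ℓ)
    (L′ : BoundedDistributiveLattice c′ ℓ′)
    (φ : LatticeMap L L′) →
    Injective (BoundedDistributiveLattice._≈_ L) (BoundedDistributiveLattice._≈_ L′) (LatticeMap.to φ) →
    (B : BooleanAlgebra b β)
    (fin : Finite (BooleanAlgebra.setoid B)) →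
    Discrete (BooleanAlgebra.setoid B) →
    Conservative (inducedInterpretation B fin φ)
proposition3p16 L L′ φ φ-injective B fin _≟_ X Y d =
  LatticeMaps.complete B fin coords L _≟_ Y
    (⊩-reflected B coords φ φ-injective (LatticeMaps.sound B fin coords L′ d))
  where
  coords = FiniteBooleanAlgebra.coordinates B _≟_ fin
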